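{- Let $G$ be a nice graph with $\mathrm{mad}(G)\leq 3$. Then, for every set $W$ of $|E(G)|+6$ distinct strictly positive integers, there exists an edge-injective neighbour-sum-distinguishing $W$-edge-weighting of $G$. In particular, $\chi^{e,1}_\Sigma(G)\leq |E(G)|+6$.
   Context: All graphs are finite, simple, undirected and loopless. A graph is nice if none of its connected components is isomorphic to $K_2$. The maximum average degree is $\mathrm{mad}(G)=\max\{2|E(H)|/|V(H)| : H \text{ a non-empty subgraph of } G\}$. For a set $W$ of weights, a $W$-edge-weighting of $G$ is a map $w:E(G)\to W$; a $k$-edge-weighting is a $\{1,\dots,k\}$-edge-weighting. For a vertex $v$, $\sigma_w(v)=\sum_{u\in N(v)} w(vu)$. The weighting $w$ is neighbour-sum-distinguishing if $\sigma_w(u)\neq\sigma_w(v)$ for every edge $uv$, and edge-injective if no two distinct edges receive the same weight. For a nice graph $G$, $\chi^{e,1}_\Sigma(G)$ is the smallest $k$ such that $G$ admits an edge-injective neighbour-sum-distinguishing $k$-edge-weighting. -}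

module Defs where

open import Data.Nat using (ℕ; zero; suc; _+_; _*_; _≤_; _<_; _<ᵇ_)
open import Data.Fin using (Fin; zero; suc; toℕ)
open import Data.Bool using (Bool; true; false; if_then_else_; _∧_)
open import Data.Product using (Σ; ∃; _×_; _,_)
open import Data.Empty using (⊥)
import Data.Sum
open import Relation.Nullary using (¬_)
open import Relation.Binary.PropositionalEquality using (_≡_; _≢_)

sumFin : ∀ {n} → (Fin n → ℕ) → ℕ
sumFin {zero}  f = 0
sumFin {suc n} f = f zero + sumFin (λ i → f (suc i))

record Graph (n : ℕ) : Set where
  field
    adj   : Fin n → Fin n → Bool
    sym   : ∀ u v → adj u v ≡ adj v u
    irrefl : ∀ v → adj v v ≡ false
open Graph public

Edge : ∀ {n} → Graph n → Fin n → Fin n → Set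
Edge G u v = adj G u v ≡ true

numEdges : ∀ {n} → Graph n → ℕ
numEdges {n} G =
  sumFin (λ u → sumFin (λ v → if (toℕ u <ᵇ toℕ v) ∧ adj G u v then 1 else 0))

record Subgraph {n : ℕ} (G : Graph n) : Set where
  field
    S     : Fin n → Bool
    F     : Fin n → Fin n → Bool
    F-sym : ∀ u v → F u v ≡ F v u
    F⊆E   : ∀ u v → F u v ≡ true → adj G u v ≡ true
    F⊆S   : ∀ u v → F u v ≡ true → (S u ≡ true) × (S v ≡ true)
open Subgraph public

numV : ∀ {n} {G : Graph n} → Subgraph G → ℕ
numV H = sumFin (λ v → if S H v then 1 else 0)

numE : ∀ {n} {G : Graph n} → Subgraph G → ℕ
numE H = sumFin (λ u → sumFin (λ v → if (toℕ u <ᵇ toℕ v) ∧ F H u v then 1 else 0))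

-- mad(G) ≤ 3 : for every non-empty subgraph H, 2|E(H)|/|V(H)| ≤ 3,
-- i.e. 2|E(H)| ≤ 3|V(H)|.
madAtMost3 : ∀ {n} → Graph n → Set
madAtMost3 G = ∀ (H : Subgraph G) → 0 < numV H → 2 * numE H ≤ 3 * numV H

-- G is nice: no connected component is isomorphic to K₂.  A component is
-- isomorphic to K₂ exactly when it consists of an edge uv such that u has
-- no neighbour other than v and v has no neighbour other than u.
Nice : ∀ {n} → Graph n → Set
Nice {n} G = ¬ (Σ (Fin n) λ u → Σ (Fin n) λ v → Edge G u v ×
                 (∀ x → Edge G u x → x ≡ v) × (∀ x → Edge G v x → x ≡ u))

-- Edge weightings are represented as functions w : Fin n → Fin n → ℕ,
-- of which only the values on edges matter; they must be symmetric on edges.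
WellDefined : ∀ {n} → Graph n → (Fin n → Fin n → ℕ) → Set
WellDefined G w = ∀ u v → Edge G u v → w u v ≡ w v u

ValuedIn : ∀ {n} → Graph n → (Fin n → Fin n → ℕ) → (ℕ → Set) → Set
ValuedIn G w P = ∀ u v → Edge G u v → P (w u v)

σ : ∀ {n} → Graph n → (Fin n → Fin n → ℕ) → Fin n → ℕ
σ G w v = sumFin (λ u → if adj G v u then w v u else 0)

NeighbourSumDistinguishing : ∀ {n} → Graph n → (Fin n → Fin n → ℕ) → Set
NeighbourSumDistinguishing G w = ∀ u v → Edge G u v → σ G w u ≢ σ G w v

EdgeInjective : ∀ {n} → Graph n → (Fin n → Fin n → ℕ) → Set
EdgeInjective G w = ∀ u v x y → Edge G u v → Edge G x y → w u v ≡ w x y →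
  ((u ≡ x) × (v ≡ y)) Data.Sum.⊎ ((u ≡ y) × (v ≡ x))


GoodWeighting : ∀ {n} → Graph n → (ℕ → Set) → Set
GoodWeighting {n} G P = Σ (Fin n → Fin n → ℕ) λ w → WellDefined G w × ValuedIn G w P ×
  EdgeInjective G w × NeighbourSumDistinguishing G w

chiE1≤ : ∀ {n} → Graph n → ℕ → Set
chiE1≤ G k = GoodWeighting G (λ x → (1 ≤ x) × (x ≤ k))

{-# OPTIONS --safe #-}
module Submission where

-- Induct on the number of edges, asking only that the ends of each edge between vertices
-- of degree at least 2 get distinct sums.  After k edges are deleted and the rest is
-- labelled, k + 6 labels are unused, so the last deleted edge can avoid 6 values and the
-- one before it 7.  Three configurations can therefore be deleted and restored:
--   * a leaf whose neighbour has at most 6 non-leaf neighbours;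
--   * an edge between two vertices of degree 2;
--   * edges ux, ux′ with deg u + deg x ≤ 8 and deg x′ ≤ 6.
-- If none occurs, let the core consist of the vertices of degree at least 2.  Each core
-- vertex has charge (core degree − 3) and sends 1/2 to every neighbour of core degree 2,
-- and vertices of core degree at least 7 send 1/2 to all neighbours.  No final charge is
-- negative, while mad ≤ 3 makes the total at most 0.  So all final charges vanish, which
-- forces the core to be cubic, and then the third configuration occurs after all.

open import Defs
open import Data.Nat using (ℕ; zero; suc; pred; _+_; _*_; _∸_; _≤_; _<_; _<ᵇ_; _≤?_; z≤n; s≤s; s≤s⁻¹)
open import Data.Nat.Properties hiding (suc-injective)
open import Data.Fin using (Fin; zero; suc; toℕ)
import Data.Fin as Fin
open import Data.Fin.Properties using (any?; toℕ-injective; suc-injective; toℕ<n)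
open import Data.Bool using (Bool; true; false; if_then_else_; _∧_; not)
import Data.Bool as Bool
open import Data.Bool.Properties using (¬-not; not-¬)
open import Data.List using (List; []; _∷_; _++_; length; map; filter; tabulate; allFin)
open import Data.List.Properties using (length-map; length-++; length-tabulate; filter-notAll)
open import Data.List.Membership.Propositional using (_∈_; _∉_)
open import Data.List.Membership.Propositional.Properties using (∈-filter⁺; ∈-allFin; ∈-map⁺; ∈-++⁺ˡ; ∈-++⁺ʳ; ∈-tabulate⁻)
open import Data.List.Membership.DecPropositional _≟_ using (_∈?_)
open import Data.List.Relation.Unary.Any using (here; there)
import Data.List.Relation.Unary.Any as Any
open import Data.List.Relation.Unary.All using (lookup)
open import Data.List.Relation.Unary.AllPairs using (_∷_)
open import Data.List.Relation.Unary.Unique.Propositional using (Unique)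
import Data.List.Relation.Unary.Unique.Propositional.Properties as Uniqueₚ
open import Data.Product using (Σ; ∃; _×_; _,_; proj₁; proj₂)
open import Data.Sum using (_⊎_; inj₁; inj₂)
open import Data.Empty using (⊥-elim)
open import Relation.Nullary using (¬_; Dec; yes; no; does; _×-dec_; _⊎-dec_; ¬?)
open import Relation.Nullary.Decidable using (dec-true; dec-false)
open import Relation.Binary.PropositionalEquality hiding (sym)
import Relation.Binary.PropositionalEquality as ≡
open import Relation.Binary.Definitions using (tri<; tri≈; tri>)
open import Function using (_∘_)
open import Function.Definitions using (Injective)
open import Algebra.Properties.CommutativeSemigroup +-commutativeSemigroup using (interchange; x∙yz≈y∙xz)

private
  variable
    n : ℕ

-- Finite sums

sum-cong : {f g : Fin n → ℕ} → (∀ i → f i ≡ g i) → sumFin f ≡ sumFin g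
sum-cong {zero}  f≡g = refl
sum-cong {suc n} f≡g = cong₂ _+_ (f≡g zero) (sum-cong (f≡g ∘ suc))

sum-mono : {f g : Fin n → ℕ} → (∀ i → f i ≤ g i) → sumFin f ≤ sumFin g
sum-mono {zero}  f≤g = z≤n
sum-mono {suc n} f≤g = +-mono-≤ (f≤g zero) (sum-mono (f≤g ∘ suc))

sum-strict : {f g : Fin n → ℕ} → (∀ i → f i ≤ g i) → ∀ j → f j < g j → sumFin f < sumFin g
sum-strict f≤g zero    lt = +-mono-<-≤ lt (sum-mono (f≤g ∘ suc))
sum-strict f≤g (suc j) lt = +-mono-≤-< (f≤g zero) (sum-strict (f≤g ∘ suc) j lt)

sum-zero : ∀ n → sumFin {n} (λ _ → 0) ≡ 0
sum-zero zero    = refl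
sum-zero (suc n) = sum-zero n

sum-+ : (f g : Fin n → ℕ) → sumFin (λ i → f i + g i) ≡ sumFin f + sumFin g
sum-+ {zero}  f g = refl
sum-+ {suc n} f g = trans (cong (f zero + g zero +_) (sum-+ (f ∘ suc) (g ∘ suc)))
  (interchange (f zero) (g zero) _ _)

sum-swap : ∀ {m} (f : Fin m → Fin n → ℕ) →
  sumFin (λ i → sumFin (f i)) ≡ sumFin (λ j → sumFin (λ i → f i j))
sum-swap {n} {zero}  f = ≡.sym (sum-zero n)
sum-swap {n} {suc m} f = trans (cong (sumFin (f zero) +_) (sum-swap (f ∘ suc)))
  (≡.sym (sum-+ (f zero) _))

sum-* : ∀ k (f : Fin n → ℕ) → sumFin (λ i → k * f i) ≡ k * sumFin f
sum-* {zero}  k f = ≡.sym (*-zeroʳ k)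
sum-* {suc n} k f = trans (cong (k * f zero +_) (sum-* k (f ∘ suc)))
  (≡.sym (*-distribˡ-+ k (f zero) _))

sum-update : {f g : Fin n → ℕ} (j : Fin n) → f j ≡ 0 → (∀ i → i ≢ j → g i ≡ f i) →
  sumFin g ≡ g j + sumFin f
sum-update {f = f} {g} zero fj≡0 eq =
  cong (g zero +_) (trans (sum-cong (λ i → eq (suc i) λ ())) (cong (_+ sumFin (f ∘ suc)) (≡.sym fj≡0)))
sum-update {f = f} {g} (suc j) fj≡0 eq =
  trans (cong₂ _+_ (eq zero λ ()) (sum-update j fj≡0 (λ i i≢j → eq (suc i) (i≢j ∘ suc-injective))))
    (x∙yz≈y∙xz (f zero) (g (suc j)) _)

sum-single : {f : Fin n → ℕ} (j : Fin n) → (∀ i → i ≢ j → f i ≡ 0) → sumFin f ≡ f j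
sum-single {n} {f} j eq = trans (sum-update j refl eq) (trans (cong (f j +_) (sum-zero n)) (+-identityʳ _))

term≤sum : (f : Fin n → ℕ) (j : Fin n) → f j ≤ sumFin f
term≤sum f zero    = m≤m+n _ _
term≤sum f (suc j) = ≤-trans (term≤sum (f ∘ suc) j) (m≤n+m _ _)

two-terms≤sum : (f : Fin n → ℕ) {i j : Fin n} → i ≢ j → f i + f j ≤ sumFin f
two-terms≤sum f {zero}  {zero}  i≢j = ⊥-elim (i≢j refl)
two-terms≤sum f {zero}  {suc j} i≢j = +-monoʳ-≤ (f zero) (term≤sum (f ∘ suc) j)
two-terms≤sum f {suc i} {zero}  i≢j =
  subst (_≤ sumFin f) (+-comm (f zero) _) (+-monoʳ-≤ (f zero) (term≤sum (f ∘ suc) i))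
two-terms≤sum f {suc i} {suc j} i≢j =
  ≤-trans (two-terms≤sum (f ∘ suc) (i≢j ∘ cong suc)) (m≤n+m _ _)

-- Counting

⟦_⟧ : Bool → ℕ
⟦ b ⟧ = if b then 1 else 0

count : (Fin n → Bool) → ℕ
count p = sumFin (λ i → ⟦ p i ⟧)

⟦⟧-mono : ∀ {p q} → (p ≡ true → q ≡ true) → ⟦ p ⟧ ≤ ⟦ q ⟧
⟦⟧-mono {false} h = z≤n
⟦⟧-mono {true}  h rewrite h refl = ≤-refl

⟦⟧-true : ∀ {p} → p ≡ true → ⟦ p ⟧ ≡ 1
⟦⟧-true refl = refl

⟦⟧-false : ∀ {p} → ¬ (p ≡ true) → ⟦ p ⟧ ≡ 0
⟦⟧-false {false} h = refl
⟦⟧-false {true}  h = ⊥-elim (h refl)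

⟦⟧≤1 : ∀ p → ⟦ p ⟧ ≤ 1
⟦⟧≤1 false = z≤n
⟦⟧≤1 true  = ≤-refl

∧-true : ∀ {p q} → p ∧ q ≡ true → p ≡ true × q ≡ true
∧-true {true} {true} refl = refl , refl

∧-true⁺ : ∀ {p q} → p ≡ true → q ≡ true → p ∧ q ≡ true
∧-true⁺ refl refl = refl

dec-true⁻ : ∀ {A : Set} (a? : Dec A) → does a? ≡ true → A
dec-true⁻ (yes a) _ = a

count-mono : (p q : Fin n → Bool) → (∀ i → p i ≡ true → q i ≡ true) → count p ≤ count q
count-mono p q h = sum-mono (⟦⟧-mono ∘ h)

count-none : (p : Fin n → Bool) → (∀ i → ¬ p i ≡ true) → count p ≡ 0
count-none {n} p none = trans (sum-cong (λ i → ⟦⟧-false (none i))) (sum-zero n)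

count≤1 : {p : Fin n → Bool} (x : Fin n) → (∀ y → p y ≡ true → y ≡ x) → count p ≤ 1
count≤1 {p = p} x h =
  subst (_≤ 1) (≡.sym (sum-single x (λ i i≢x → ⟦⟧-false (i≢x ∘ h i)))) (⟦⟧≤1 (p x))

count-other : {p : Fin n → Bool} → 2 ≤ count p → ∀ x → ∃ λ y → y ≢ x × p y ≡ true
count-other {p = p} 2≤ x with any? (λ y → ¬? (y Fin.≟ x) ×-dec (p y Bool.≟ true))
... | yes found = found
... | no  none  = ⊥-elim (<⇒≱ 2≤ (count≤1 x only))
  where
  only : ∀ y → p y ≡ true → y ≡ x
  only y py with y Fin.≟ x
  ... | yes y≡x = y≡x
  ... | no  y≢x = ⊥-elim (none (y , y≢x , py))

count-unique : (p : Fin n → Bool) → count p ≤ 1 → ∀ {x y} → p x ≡ true → p y ≡ true → x ≡ y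
count-unique p ≤1 {x} {y} px py with x Fin.≟ y
... | yes x≡y = x≡y
... | no  x≢y = ⊥-elim (<⇒≱ (subst₂ (λ k l → k + l ≤ count p) (⟦⟧-true px) (⟦⟧-true py)
                  (two-terms≤sum (λ i → ⟦ p i ⟧) x≢y)) ≤1)

-- Lists of vertices and the choice of a fresh element

select : (Fin n → Bool) → List (Fin n)
select p = filter (λ i → p i Bool.≟ true) (allFin _)

length-select : (p : Fin n → Bool) → length (select p) ≡ count p
length-select p = go (λ i → i)
  where
  go : ∀ {m} (f : Fin m → Fin _) →
    length (filter (λ i → p i Bool.≟ true) (tabulate f)) ≡ sumFin (λ i → ⟦ p (f i) ⟧)
  go {zero}  f = refl
  go {suc m} f with p (f zero)
  ... | true  = cong suc (go (f ∘ suc))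
  ... | false = go (f ∘ suc)

∈-select : {p : Fin n → Bool} {i : Fin n} → p i ≡ true → i ∈ select p
∈-select {p = p} {i} = ∈-filter⁺ (λ i → p i Bool.≟ true) (∈-allFin i)

-- Pigeonhole, with repetitions allowed in `B`. If the head `x` of `L` lies in `B`, striking every
-- `x` from `B` shortens it by at least one. The element then found in the tail differs from `x`
-- because `L` is repetition-free, so it avoids all of `B`.
fresh : ∀ {L} B → Unique L → length B < length L → ∃ λ c → c ∈ L × c ∉ B
fresh {x ∷ L} B (x∉L ∷ uL) |B|<|L| with x ∈? B
... | no  x∉B = x , here refl , x∉B
... | yes x∈B with fresh (filter (λ y → ¬? (y ≟ x)) B) uL
                     (<-≤-trans (filter-notAll _ B (Any.map (λ x≡y y≢x → y≢x (≡.sym x≡y)) x∈B)) (s≤s⁻¹ |B|<|L|))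
...   | c , c∈L , c∉ = c , there c∈L , λ c∈B → c∉ (∈-filter⁺ _ c∈B λ c≡x → lookup x∉L c∈L (≡.sym c≡x))

-- Graphs

deg : Graph n → Fin n → ℕ
deg G v = count (adj G v)

Edge-sym : (G : Graph n) {u v : Fin n} → Edge G u v → Edge G v u
Edge-sym G {u} {v} e = trans (sym G v u) e

Edge-≢ : (G : Graph n) {u v : Fin n} → Edge G u v → u ≢ v
Edge-≢ G {u} e refl with trans (≡.sym e) (irrefl G u)
... | ()

Joins : (u v a b : Fin n) → Set
Joins u v a b = (a ≡ u × b ≡ v) ⊎ (a ≡ v × b ≡ u)

-- Opaque so that `does (joins? u v a b)` stays one term, which `with` and `rewrite` can abstract,
-- instead of unfolding into a disjunction of comparisons.
opaque
  joins? : (u v a b : Fin n) → Dec (Joins u v a b)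
  joins? u v a b = (a Fin.≟ u ×-dec b Fin.≟ v) ⊎-dec (a Fin.≟ v ×-dec b Fin.≟ u)

Joins-sym : {u v a b : Fin n} → Joins u v a b → Joins u v b a
Joins-sym (inj₁ (p , q)) = inj₂ (q , p)
Joins-sym (inj₂ (p , q)) = inj₁ (q , p)

joins?-sym : (u v a b : Fin n) → does (joins? u v a b) ≡ does (joins? u v b a)
joins?-sym u v a b with joins? u v a b
... | yes j = ≡.sym (dec-true (joins? u v b a) (Joins-sym j))
... | no ¬j = ≡.sym (dec-false (joins? u v b a) (¬j ∘ Joins-sym))

¬Joins : {u v a b : Fin n} → a ≢ u → a ≢ v → ¬ Joins u v a b
¬Joins a≢u a≢v (inj₁ (a≡u , _)) = a≢u a≡u
¬Joins a≢u a≢v (inj₂ (a≡v , _)) = a≢v a≡v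

¬Joins-other : {u v b : Fin n} → b ≢ v → b ≢ u → ¬ Joins u v u b
¬Joins-other b≢v b≢u (inj₁ (_ , b≡v)) = b≢v b≡v
¬Joins-other b≢v b≢u (inj₂ (_ , b≡u)) = b≢u b≡u

delete : Graph n → Fin n → Fin n → Graph n
delete G u v = record
  { adj    = λ a b → adj G a b ∧ not (does (joins? u v a b))
  ; sym    = λ a b → cong₂ (λ p q → p ∧ not q) (sym G a b) (joins?-sym u v a b)
  ; irrefl = λ a → cong (_∧ _) (irrefl G a)
  }

module _ (G : Graph n) {u v : Fin n} where

  delete-⊆ : ∀ {a b} → Edge (delete G u v) a b → Edge G a b
  delete-⊆ = proj₁ ∘ ∧-true

  delete-∌ : ∀ {a b} → Edge (delete G u v) a b → ¬ Joins u v a b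
  delete-∌ {a} {b} e j with trans (≡.sym (proj₂ (∧-true {adj G a b} e))) (cong not (dec-true (joins? u v a b) j))
  ... | ()

  delete-keeps : ∀ {a b} → ¬ Joins u v a b → Edge G a b → Edge (delete G u v) a b
  delete-keeps {a} {b} ¬j e = ∧-true⁺ e (cong not (dec-false (joins? u v a b) ¬j))

  delete-deg-≡ : ∀ {a} → a ≢ u → a ≢ v → deg (delete G u v) a ≡ deg G a
  delete-deg-≡ {a} a≢u a≢v = ≤-antisym (count-mono (adj (delete G u v) a) (adj G a) (λ _ → delete-⊆))
    (count-mono (adj G a) (adj (delete G u v) a) (λ _ → delete-keeps (¬Joins a≢u a≢v)))

  delete-deg-< : ∀ {a b} → Joins u v a b → Edge G a b → deg (delete G u v) a < deg G a
  delete-deg-< {a} {b} j e = sum-strict (λ _ → ⟦⟧-mono delete-⊆) b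
    (subst₂ _<_ (≡.sym (⟦⟧-false (λ e' → delete-∌ e' j))) (≡.sym (⟦⟧-true e)) (s≤s z≤n))

  delete-deg-≤ : ∀ a → deg (delete G u v) a ≤ deg G a
  delete-deg-≤ a = count-mono (adj (delete G u v) a) (adj G a) (λ _ → delete-⊆)

  private
    shrink : ∀ p a b → p ∧ adj (delete G u v) a b ≡ true → p ∧ adj G a b ≡ true
    shrink p a b h = let p≡true , e = ∧-true {p} h in ∧-true⁺ p≡true (delete-⊆ e)
    strict : ∀ {a b} → toℕ a < toℕ b → Joins u v a b → Edge G a b → numEdges (delete G u v) < numEdges G
    strict {a} {b} a<b j e = sum-strict (λ c → sum-mono λ d → ⟦⟧-mono (shrink (toℕ c <ᵇ toℕ d) c d)) a
      (sum-strict (λ d → ⟦⟧-mono (shrink (toℕ a <ᵇ toℕ d) a d)) b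
        (subst₂ _<_ (≡.sym (⟦⟧-false λ h → delete-∌ (proj₂ (∧-true {toℕ a <ᵇ toℕ b} h)) j))
          (≡.sym (⟦⟧-true (∧-true⁺ (dec-true (toℕ a <? toℕ b) a<b) e))) (s≤s z≤n)))

  -- `numEdges` sees an edge only at the ordered pair with the smaller end first, so the term that
  -- drops depends on which of `u` and `v` is smaller.
  delete-numEdges-< : Edge G u v → numEdges (delete G u v) < numEdges G
  delete-numEdges-< e with <-cmp (toℕ u) (toℕ v)
  ... | tri< u<v _ _ = strict u<v (inj₁ (refl , refl)) e
  ... | tri≈ _ u≡v _ = ⊥-elim (Edge-≢ G e (toℕ-injective u≡v))
  ... | tri> _ _ v<u = strict v<u (inj₂ (refl , refl)) (Edge-sym G e)

delete-mad : (G : Graph n) {u v : Fin n} → madAtMost3 G → madAtMost3 (delete G u v)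
delete-mad G mad H = mad record
  { S = S H ; F = F H ; F-sym = F-sym H ; F⊆S = F⊆S H
  ; F⊆E = λ a b f → delete-⊆ G (F⊆E H a b f) }

-- Injective labellings and their extension by one edge

-- The zero weights off the edges let `vsum` run over all vertices without testing adjacency. The
-- list `used` is carried along so that the number of labels taken is bounded by `numEdges` without
-- enumerating the edges.
record Labelling (G : Graph n) (L : List ℕ) : Set where
  field
    wt      : Fin n → Fin n → ℕ
    wt-sym  : ∀ a b → wt a b ≡ wt b a
    wt-off  : ∀ a b → ¬ Edge G a b → wt a b ≡ 0
    wt∈L    : ∀ a b → Edge G a b → wt a b ∈ L
    wt-inj  : EdgeInjective G wt
    used    : List ℕ
    wt∈used : ∀ a b → Edge G a b → wt a b ∈ used
    used≤   : length used ≤ numEdges G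

  vsum : Fin n → ℕ
  vsum a = sumFin (wt a)

  vsum-leaf : ∀ {a b} → (∀ x → Edge G a x → x ≡ b) → vsum a ≡ wt a b
  vsum-leaf {a} {b} only = sum-single b (λ x x≢b → wt-off a x (x≢b ∘ only x))

-- Edges at vertices of degree 1 are left out: they cause no conflict once K₂-components
-- are excluded, and without them the induction need not preserve niceness.
Distinguishing : {G : Graph n} {L : List ℕ} → Labelling G L → Set
Distinguishing {G = G} ℓ = ∀ a b → Edge G a b → 2 ≤ deg G a → 2 ≤ deg G b → vsum a ≢ vsum b
  where open Labelling ℓ

Solution : Graph n → List ℕ → Set
Solution G L = Σ (Labelling G L) Distinguishing

Joins-unique : {u v a b x y : Fin n} → Joins u v a b → Joins u v x y → Joins x y a b
Joins-unique (inj₁ (refl , refl)) (inj₁ (refl , refl)) = inj₁ (refl , refl)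
Joins-unique (inj₁ (refl , refl)) (inj₂ (refl , refl)) = inj₂ (refl , refl)
Joins-unique (inj₂ (refl , refl)) (inj₁ (refl , refl)) = inj₂ (refl , refl)
Joins-unique (inj₂ (refl , refl)) (inj₂ (refl , refl)) = inj₁ (refl , refl)

endpoint? : (u v a : Fin n) → (∃ λ z → Joins u v a z) ⊎ (a ≢ u × a ≢ v)
endpoint? u v a with a Fin.≟ u | a Fin.≟ v
... | yes a≡u | _       = inj₁ (v , inj₁ (a≡u , refl))
... | no _    | yes a≡v = inj₁ (u , inj₂ (a≡v , refl))
... | no a≢u  | no a≢v  = inj₂ (a≢u , a≢v)

module Extend (G : Graph n) {u v : Fin n} (uv : Edge G u v) {L : List ℕ}
  (ℓ : Labelling (delete G u v) L) {c : ℕ} (c∈L : c ∈ L) (c∉used : c ∉ Labelling.used ℓ) where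

  open Labelling ℓ

  wt⁺ : Fin n → Fin n → ℕ
  wt⁺ a b = if does (joins? u v a b) then c else wt a b

  wt⁺-joins : ∀ {a b} → Joins u v a b → wt⁺ a b ≡ c
  wt⁺-joins {a} {b} j rewrite dec-true (joins? u v a b) j = refl

  wt⁺-other : ∀ {a b} → ¬ Joins u v a b → wt⁺ a b ≡ wt a b
  wt⁺-other {a} {b} ¬j rewrite dec-false (joins? u v a b) ¬j = refl

  Joins⇒Edge : ∀ {a b} → Joins u v a b → Edge G a b
  Joins⇒Edge (inj₁ (refl , refl)) = uv
  Joins⇒Edge (inj₂ (refl , refl)) = Edge-sym G uv

  wt⁺-inj : EdgeInjective G wt⁺
  wt⁺-inj a b x y ab xy eq with joins? u v a b | joins? u v x y
  ... | yes j | yes k = Joins-unique j k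
  ... | yes j | no ¬k = ⊥-elim (c∉used (subst (_∈ used) (≡.sym eq) (wt∈used x y (delete-keeps G ¬k xy))))
  ... | no ¬j | yes k = ⊥-elim (c∉used (subst (_∈ used) eq (wt∈used a b (delete-keeps G ¬j ab))))
  ... | no ¬j | no ¬k = wt-inj a b x y (delete-keeps G ¬j ab) (delete-keeps G ¬k xy) eq

  extended : Labelling G L
  extended = record
    { wt      = wt⁺
    ; wt-sym  = λ a b → cong₂ (λ p → if p then c else_) (joins?-sym u v a b) (wt-sym a b)
    ; wt-off  = λ a b ¬ab → trans (wt⁺-other (¬ab ∘ Joins⇒Edge)) (wt-off a b (¬ab ∘ delete-⊆ G))
    ; wt∈L    = inL
    ; wt-inj  = wt⁺-inj
    ; used    = c ∷ used
    ; wt∈used = inUsed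
    ; used≤   = ≤-trans (s≤s used≤) (delete-numEdges-< G uv)
    }
    where
    inL : ∀ a b → Edge G a b → wt⁺ a b ∈ L
    inL a b ab with joins? u v a b
    ... | yes _ = c∈L
    ... | no ¬j = wt∈L a b (delete-keeps G ¬j ab)
    inUsed : ∀ a b → Edge G a b → wt⁺ a b ∈ c ∷ used
    inUsed a b ab with joins? u v a b
    ... | yes _ = here refl
    ... | no ¬j = there (wt∈used a b (delete-keeps G ¬j ab))

  open Labelling extended using () renaming (vsum to vsum⁺) public

  vsum⁺-off : ∀ {a} → a ≢ u → a ≢ v → vsum⁺ a ≡ vsum a
  vsum⁺-off a≢u a≢v = sum-cong (λ b → wt⁺-other {b = b} (¬Joins a≢u a≢v))

  -- Before the extension the missing edge contributes 0 by `wt-off`, so exactly one summand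
  -- changes, from 0 to `c`.
  vsum⁺-end : ∀ {a z} → Joins u v a z → vsum⁺ a ≡ c + vsum a
  vsum⁺-end {a} {z} j =
    trans (sum-update z (wt-off a z λ az → delete-∌ G az j)
            (λ b b≢z → wt⁺-other λ k → b≢z (same-end j k)))
      (cong (_+ vsum a) (wt⁺-joins j))
    where
    same-end : ∀ {b} → Joins u v a z → Joins u v a b → b ≡ z
    same-end (inj₁ (refl , refl)) (inj₁ (_ , refl))    = refl
    same-end (inj₁ (refl , refl)) (inj₂ (u≡v , refl)) = u≡v
    same-end (inj₂ (refl , refl)) (inj₁ (v≡u , refl)) = v≡u
    same-end (inj₂ (refl , refl)) (inj₂ (_ , refl))    = refl

  -- Case split on which of `a`, `b` are ends of the restored edge. When both are, `c` is added on
  -- both sides and cancels, which is why the first premise does not mention `c`.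
  separate : ∀ {a b} → Edge G a b →
    (Joins u v a b → vsum a ≢ vsum b) →
    (∀ z → Joins u v a z → b ≢ u → b ≢ v → c + vsum a ≢ vsum b) →
    (∀ z → Joins u v b z → a ≢ u → a ≢ v → c + vsum b ≢ vsum a) →
    (a ≢ u → a ≢ v → b ≢ u → b ≢ v → vsum a ≢ vsum b) →
    vsum⁺ a ≢ vsum⁺ b
  separate {a} {b} ab both left right neither eq with endpoint? u v a | endpoint? u v b
  ... | inj₁ (z , j) | inj₁ (y , k) = both (joined j k)
        (+-cancelˡ-≡ c _ _ (trans (≡.sym (vsum⁺-end j)) (trans eq (vsum⁺-end k))))
    where
    joined : ∀ {z y} → Joins u v a z → Joins u v b y → Joins u v a b
    joined (inj₁ (refl , _)) (inj₁ (refl , _)) = ⊥-elim (Edge-≢ G ab refl)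
    joined (inj₁ (refl , _)) (inj₂ (refl , _)) = inj₁ (refl , refl)
    joined (inj₂ (refl , _)) (inj₁ (refl , _)) = inj₂ (refl , refl)
    joined (inj₂ (refl , _)) (inj₂ (refl , _)) = ⊥-elim (Edge-≢ G ab refl)
  ... | inj₁ (z , j) | inj₂ (b≢u , b≢v) =
        left z j b≢u b≢v (trans (≡.sym (vsum⁺-end j)) (trans eq (vsum⁺-off b≢u b≢v)))
  ... | inj₂ (a≢u , a≢v) | inj₁ (y , k) =
        right y k a≢u a≢v (trans (≡.sym (vsum⁺-end k)) (trans (≡.sym eq) (vsum⁺-off a≢u a≢v)))
  ... | inj₂ (a≢u , a≢v) | inj₂ (b≢u , b≢v) = neither a≢u a≢v b≢u b≢v
        (trans (≡.sym (vsum⁺-off a≢u a≢v)) (trans eq (vsum⁺-off b≢u b≢v)))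

-- One forbidden label per selected vertex `b`: the solution `c` of `c + k ≡ s b`. If `s b < k`
-- there is no solution, and truncated subtraction merely forbids 0 as well.
conflicts : (s : Fin n → ℕ) → ℕ → (Fin n → Bool) → List ℕ
conflicts s k p = map (λ b → s b ∸ k) (select p)

length-conflicts : (s : Fin n → ℕ) (k : ℕ) (p : Fin n → Bool) → length (conflicts s k p) ≡ count p
length-conflicts s k p = trans (length-map _ (select p)) (length-select p)

avoids : (s : Fin n → ℕ) (k : ℕ) (p : Fin n → Bool) {c : ℕ} → c ∉ conflicts s k p →
  ∀ {b} → p b ≡ true → c + k ≢ s b
avoids s k p {c} c∉ pb eq = c∉ (subst (_∈ conflicts s k p) (trans (cong (_∸ k) (≡.sym eq)) (m+n∸n≡m c k))
  (∈-map⁺ (λ b → s b ∸ k) (∈-select pb)))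

fresh-beyond : ∀ {L} U B → Unique L → length U + length B < length L → ∃ λ c → c ∈ L × c ∉ U × c ∉ B
fresh-beyond U B uL lt with fresh (U ++ B) uL (subst (_< _) (≡.sym (length-++ U)) lt)
... | c , c∈L , c∉ = c , c∈L , c∉ ∘ ∈-++⁺ˡ , c∉ ∘ ∈-++⁺ʳ U

-- The label of `uv` must avoid `used` and one value for each remaining edge at `u` or `v`; the
-- first numeric premise leaves room for that. Since the label cancels between `u` and `v`, their
-- sums have to differ beforehand. Edges missing both ends keep their sums.
complete : (G : Graph n) {u v : Fin n} {L : List ℕ} → Unique L → Edge G u v →
  (ℓ : Labelling (delete G u v) L) → let open Labelling ℓ in
  length used + (deg (delete G u v) u + deg (delete G u v) v) < length L →
  vsum u ≢ vsum v →
  (∀ a b → a ≢ u → a ≢ v → b ≢ u → b ≢ v → Edge G a b → 2 ≤ deg G a → 2 ≤ deg G b → vsum a ≢ vsum b) →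
  Solution G L
complete {n} G {u} {v} {L} uL uv ℓ room su≢sv off
  with fresh-beyond (Labelling.used ℓ) (conflictsAt u ++ conflictsAt v) uL
         (subst (λ k → _ + k < _) (≡.sym (trans (length-++ (conflictsAt u))
           (cong₂ _+_ (length-conflicts vsum (vsum u) _) (length-conflicts vsum (vsum v) _)))) room)
  where
  open Labelling ℓ
  conflictsAt : Fin n → List ℕ
  conflictsAt a = conflicts vsum (vsum a) (adj (delete G u v) a)
... | c , c∈L , c∉used , c∉ = extended , λ a b ab 2≤a 2≤b → separate ab
        (λ { (inj₁ (refl , refl)) → su≢sv ; (inj₂ (refl , refl)) → ≢-sym su≢sv })
        (λ z j b≢u b≢v → end j ab b≢u b≢v)
        (λ z j a≢u a≢v → end j (Edge-sym G ab) a≢u a≢v)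
        (λ a≢u a≢v b≢u b≢v → off a b a≢u a≢v b≢u b≢v ab 2≤a 2≤b)
  where
  open Labelling ℓ
  open Extend G uv ℓ c∈L c∉used
  end : ∀ {a b z} → Joins u v a z → Edge G a b → b ≢ u → b ≢ v → c + vsum a ≢ vsum b
  end {a} {b} j ab b≢u b≢v = avoids vsum (vsum a) (adj (delete G u v) a) (c∉ ∘ place j)
    (delete-keeps G (¬Joins b≢u b≢v ∘ Joins-sym) ab)
    where
    place : ∀ {x a z} → Joins u v a z → x ∈ conflicts vsum (vsum a) (adj (delete G u v) a) →
      x ∈ conflicts vsum (vsum u) (adj (delete G u v) u) ++ conflicts vsum (vsum v) (adj (delete G u v) v)
    place (inj₁ (refl , _)) = ∈-++⁺ˡ
    place (inj₂ (refl , _)) = ∈-++⁺ʳ (conflicts vsum (vsum u) (adj (delete G u v) u))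

-- Reducible configurations

inCore : Graph n → Fin n → Bool
inCore G v = does (2 ≤? deg G v)

-- Only the second vertex is tested, so that core neighbours can be counted at any vertex, in the
-- core or not.
coreAdj : Graph n → Fin n → Fin n → Bool
coreAdj G u v = adj G u v ∧ inCore G v

-- Pairs with an end of degree at most 1 are exempt, so `uv` itself imposes nothing. The new label
-- only has to separate `u` from its core neighbours, which forbids at most 6 values.
leaf-reduction : (G : Graph n) {u v : Fin n} {L : List ℕ} → Unique L → numEdges G + 6 ≤ length L →
  Edge G u v → deg G v ≤ 1 → count (coreAdj G u) ≤ 6 →
  Solution (delete G u v) L → Solution G L
leaf-reduction G {u} {v} {L} uL enough uv v≤1 u≤6 (ℓ , dist)
  with fresh-beyond (Labelling.used ℓ) (conflicts (Labelling.vsum ℓ) (Labelling.vsum ℓ u) (coreAdj G u)) uL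
         (≤-trans (+-mono-≤ (≤-trans (s≤s (Labelling.used≤ ℓ)) (delete-numEdges-< G uv))
           (≤-trans (≤-reflexive (length-conflicts (Labelling.vsum ℓ) (Labelling.vsum ℓ u) (coreAdj G u))) u≤6)) enough)
... | c , c∈L , c∉used , c∉ = extended , λ a b ab 2≤a 2≤b → separate ab
        (λ { (inj₁ (refl , refl)) → ⊥-elim (<⇒≱ 2≤b v≤1) ; (inj₂ (refl , refl)) → ⊥-elim (<⇒≱ 2≤a v≤1) })
        (λ z j _ _ → end j ab 2≤a 2≤b)
        (λ z j _ _ → end j (Edge-sym G ab) 2≤b 2≤a)
        (λ a≢u a≢v b≢u b≢v → dist a b (delete-keeps G (¬Joins a≢u a≢v) ab)
          (subst (2 ≤_) (≡.sym (delete-deg-≡ G a≢u a≢v)) 2≤a)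
          (subst (2 ≤_) (≡.sym (delete-deg-≡ G b≢u b≢v)) 2≤b))
  where
  open Labelling ℓ
  open Extend G uv ℓ c∈L c∉used
  end : ∀ {a b z} → Joins u v a z → Edge G a b → 2 ≤ deg G a → 2 ≤ deg G b → c + vsum a ≢ vsum b
  end {b = b} (inj₁ (refl , _)) ab _ 2≤b =
    avoids vsum (vsum u) (coreAdj G u) c∉ (∧-true⁺ ab (dec-true (2 ≤? deg G b) 2≤b))
  end (inj₂ (refl , _)) ab 2≤a _ = ⊥-elim (<⇒≱ 2≤a v≤1)

-- The two ends of the deleted edge each keep one edge; these are different edges, so
-- injectivity alone keeps the two sums apart.
thin-reduction : (G : Graph n) {x y : Fin n} {L : List ℕ} → Unique L → numEdges G + 6 ≤ length L →
  Edge G x y → deg G x ≡ 2 → deg G y ≡ 2 →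
  Solution (delete G x y) L → Solution G L
thin-reduction G {x} {y} {L} uL enough xy x≡2 y≡2 (ℓ , dist)
  with count-other {p = adj G x} (≤-reflexive (≡.sym x≡2)) y
     | count-other {p = adj G y} (≤-reflexive (≡.sym y≡2)) x
... | p , p≢y , xp | q , q≢x , yq = complete G uL xy ℓ
        (≤-trans (+-mono-≤ (≤-trans (s≤s used≤) (delete-numEdges-< G xy)) (+-mono-≤ x≤1 y≤1))
          (≤-trans (+-monoʳ-≤ (numEdges G) (s≤s (s≤s z≤n))) enough))
        sums-differ
        (λ a b a≢x a≢y b≢x b≢y ab 2≤a 2≤b → dist a b (delete-keeps G (¬Joins a≢x a≢y) ab)
          (subst (2 ≤_) (≡.sym (delete-deg-≡ G a≢x a≢y)) 2≤a)
          (subst (2 ≤_) (≡.sym (delete-deg-≡ G b≢x b≢y)) 2≤b))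
  where
  open Labelling ℓ
  x≤1 : deg (delete G x y) x ≤ 1
  x≤1 = s≤s⁻¹ (subst (deg (delete G x y) x <_) x≡2 (delete-deg-< G (inj₁ (refl , refl)) xy))
  y≤1 : deg (delete G x y) y ≤ 1
  y≤1 = s≤s⁻¹ (subst (deg (delete G x y) y <_) y≡2 (delete-deg-< G (inj₂ (refl , refl)) (Edge-sym G xy)))
  xp⁻ : Edge (delete G x y) x p
  xp⁻ = delete-keeps G (¬Joins-other p≢y (≢-sym (Edge-≢ G xp))) xp
  yq⁻ : Edge (delete G x y) y q
  yq⁻ = delete-keeps G (¬Joins q≢x (≢-sym (Edge-≢ G yq)) ∘ Joins-sym) yq
  sums-differ : vsum x ≢ vsum y
  sums-differ eq with wt-inj x p y q xp⁻ yq⁻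
      (trans (≡.sym (vsum-leaf λ z xz → count-unique (adj (delete G x y) x) x≤1 xz xp⁻))
        (trans eq (vsum-leaf λ z yz → count-unique (adj (delete G x y) y) y≤1 yz yq⁻)))
  ... | inj₁ (x≡y , _) = Edge-≢ G xy x≡y
  ... | inj₂ (_ , p≡y) = p≢y p≡y

-- The label of ux′ is chosen first and makes the partial sums at u and x differ, which
-- no choice of the label of ux could achieve afterwards.
fork-reduction : (G : Graph n) {u x x′ : Fin n} {L : List ℕ} → Unique L → numEdges G + 6 ≤ length L →
  Edge G u x → Edge G u x′ → x′ ≢ x → deg G u + deg G x ≤ 8 → deg G x′ ≤ 6 →
  Solution (delete (delete G u x) u x′) L → Solution G L
fork-reduction {n} G {u} {x} {x′} {L} uL enough ux ux′ x′≢x ux≤8 x′≤6 (ℓ , dist)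
  with fresh-beyond (Labelling.used ℓ) forbidden uL
         (≤-trans (+-mono-≤ (s≤s (Labelling.used≤ ℓ)) forbidden≤7)
         (≤-trans (≤-reflexive (+-suc (suc (numEdges G₂)) 6))
         (≤-trans (+-monoˡ-≤ 6 (≤-trans (s≤s (delete-numEdges-< G₁ ux′⁻)) (delete-numEdges-< G ux))) enough)))
  where
  open Labelling ℓ
  G₁ G₂ : Graph n
  G₁ = delete G u x
  G₂ = delete G₁ u x′
  ux′⁻ : Edge G₁ u x′
  ux′⁻ = delete-keeps G (¬Joins-other x′≢x (≢-sym (Edge-≢ G ux′))) ux′
  forbidden : List ℕ
  forbidden = (vsum x ∸ vsum u) ∷ conflicts vsum (vsum x′) (adj G₂ x′)
  forbidden≤7 : length forbidden ≤ 7
  forbidden≤7 = s≤s (≤-trans (≤-reflexive (length-conflicts vsum (vsum x′) (adj G₂ x′)))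
    (≤-trans (delete-deg-≤ G₁ x′) (≤-trans (delete-deg-≤ G x′) x′≤6)))
... | c , c∈L , c∉used , c∉ = complete G uL ux extended
        (≤-trans (+-mono-≤ (≤-trans (s≤s (Labelling.used≤ extended)) (delete-numEdges-< G ux)) degrees≤6) enough)
        sums-differ
        (λ a b a≢u a≢x b≢u b≢x ab 2≤a 2≤b → separate (delete-keeps G (¬Joins a≢u a≢x) ab)
          (λ { (inj₁ (a≡u , _)) → ⊥-elim (a≢u a≡u) ; (inj₂ (_ , b≡u)) → ⊥-elim (b≢u b≡u) })
          (λ z j b≢u b≢x′ → end j a≢u (delete-keeps G (¬Joins a≢u a≢x) ab) b≢u b≢x′)
          (λ z j a≢u a≢x′ → end j b≢u (Edge-sym G₁ (delete-keeps G (¬Joins a≢u a≢x) ab)) a≢u a≢x′)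
          (λ _ a≢x′ _ b≢x′ → dist a b
            (delete-keeps G₁ (¬Joins a≢u a≢x′) (delete-keeps G (¬Joins a≢u a≢x) ab))
            (subst (2 ≤_) (≡.sym (trans (delete-deg-≡ G₁ a≢u a≢x′) (delete-deg-≡ G a≢u a≢x))) 2≤a)
            (subst (2 ≤_) (≡.sym (trans (delete-deg-≡ G₁ b≢u b≢x′) (delete-deg-≡ G b≢u b≢x))) 2≤b)))
  where
  open Labelling ℓ
  G₁ G₂ : Graph n
  G₁ = delete G u x
  G₂ = delete G₁ u x′
  open Extend G₁ {u} {x′} (delete-keeps G (¬Joins-other x′≢x (≢-sym (Edge-≢ G ux′))) ux′) ℓ c∈L c∉used
  -- Deleting `ux` lowers the degree at both ends, turning the bound 8 into the 6 values that the
  -- last label can avoid.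
  degrees≤6 : deg G₁ u + deg G₁ x ≤ 6
  degrees≤6 = s≤s⁻¹ (s≤s⁻¹ (≤-trans (≤-reflexive (≡.sym (+-suc (suc (deg G₁ u)) (deg G₁ x))))
    (≤-trans (+-mono-≤ (delete-deg-< G (inj₁ (refl , refl)) ux)
                       (delete-deg-< G (inj₂ (refl , refl)) (Edge-sym G ux))) ux≤8)))
  sums-differ : vsum⁺ u ≢ vsum⁺ x
  sums-differ eq = c∉ (here (trans (≡.sym (m+n∸n≡m c (vsum u))) (cong (_∸ vsum u)
    (trans (≡.sym (vsum⁺-end {u} {x′} (inj₁ (refl , refl))))
      (trans eq (vsum⁺-off (≢-sym (Edge-≢ G ux)) (≢-sym x′≢x)))))))
  end : ∀ {a b z} → Joins u x′ a z → a ≢ u → Edge G₁ a b → b ≢ u → b ≢ x′ → c + vsum a ≢ vsum b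
  end (inj₁ (a≡u , _))  a≢u ab b≢u b≢x′ = ⊥-elim (a≢u a≡u)
  end (inj₂ (refl , _)) a≢u ab b≢u b≢x′ = avoids vsum (vsum x′) (adj G₂ x′) (c∉ ∘ there)
    (delete-keeps G₁ (¬Joins b≢u b≢x′ ∘ Joins-sym) ab)

-- Discharging

-- Each ordered pair is charged to its increasing orientation; exchanging the summations turns the
-- decreasing pairs into a second copy of `U`.
handshake-≤ : (A : Fin n → Fin n → Bool) → (∀ a b → A a b ≡ A b a) → (∀ a → A a a ≡ false) →
  sumFin (λ a → count (A a)) ≤ 2 * sumFin (λ a → count (λ b → (toℕ a <ᵇ toℕ b) ∧ A a b))
handshake-≤ {n} A A-sym A-irrefl = begin
  sumFin (λ a → count (A a))                        ≤⟨ sum-mono (λ a → sum-mono (λ b → split a b)) ⟩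
  sumFin (λ a → sumFin (λ b → up a b + up b a))     ≡⟨ sum-cong (λ a → sum-+ (up a) (λ b → up b a)) ⟩
  sumFin (λ a → sumFin (up a) + sumFin (λ b → up b a)) ≡⟨ sum-+ (λ a → sumFin (up a)) _ ⟩
  U + sumFin (λ a → sumFin (λ b → up b a))          ≡⟨ cong (U +_) (≡.sym (sum-swap up)) ⟩
  U + U                                             ≡⟨ cong (U +_) (≡.sym (+-identityʳ U)) ⟩
  2 * U                                             ∎
  where
  open ≤-Reasoning
  up : Fin n → Fin n → ℕ
  up a b = ⟦ (toℕ a <ᵇ toℕ b) ∧ A a b ⟧
  U : ℕ
  U = sumFin (λ a → sumFin (up a))
  up-< : ∀ {a b} → toℕ a < toℕ b → up a b ≡ ⟦ A a b ⟧
  up-< {a} {b} a<b = cong (λ p → ⟦ p ∧ A a b ⟧) (dec-true (toℕ a <? toℕ b) a<b)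
  split : ∀ a b → ⟦ A a b ⟧ ≤ up a b + up b a
  split a b with <-cmp (toℕ a) (toℕ b)
  ... | tri< a<b _ _ = ≤-trans (≤-reflexive (≡.sym (up-< a<b))) (m≤m+n _ _)
  ... | tri> _ _ b<a =
    ≤-trans (≤-reflexive (trans (cong ⟦_⟧ (A-sym a b)) (≡.sym (up-< b<a)))) (m≤n+m _ _)
  ... | tri≈ _ a≡b _ with toℕ-injective a≡b
  ...   | refl = ≤-trans (≤-reflexive (cong ⟦_⟧ (A-irrefl a))) z≤n

module Discharging (G : Graph n) (mad : madAtMost3 G)
  (no-leaf : ∀ u v → Edge G u v → deg G v ≤ 1 → ¬ count (coreAdj G u) ≤ 6)
  (no-thin : ∀ x y → Edge G x y → deg G x ≡ 2 → deg G y ≢ 2)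
  (no-fork : ∀ u x x′ → Edge G u x → Edge G u x′ → x′ ≢ x → deg G u + deg G x ≤ 8 → ¬ deg G x′ ≤ 6)
  where

  Core : Fin n → Set
  Core v = inCore G v ≡ true

  core : ∀ {v} → 2 ≤ deg G v → Core v
  core {v} = dec-true (2 ≤? deg G v)

  K : Fin n → ℕ
  K v = count (coreAdj G v)

  -- The symmetric form of `coreAdj`, as required of the edges of a subgraph.
  coreEdge : Fin n → Fin n → Bool
  coreEdge a b = inCore G a ∧ coreAdj G a b

  coreEdge⁻ : ∀ {a b} → coreEdge a b ≡ true → Core a × Edge G a b × Core b
  coreEdge⁻ {a} {b} h = let ca , h′ = ∧-true {inCore G a} h
                            ab , cb = ∧-true {adj G a b} h′ in ca , ab , cb

  coreEdge⁺ : ∀ {a b} → Core a → Edge G a b → Core b → coreEdge a b ≡ true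
  coreEdge⁺ ca ab cb = ∧-true⁺ ca (∧-true⁺ ab cb)

  coreEdge-flip : ∀ {a b} → coreEdge a b ≡ true → coreEdge b a ≡ true
  coreEdge-flip h = let ca , ab , cb = coreEdge⁻ h in coreEdge⁺ cb (Edge-sym G ab) ca

  coreEdge-sym : ∀ a b → coreEdge a b ≡ coreEdge b a
  coreEdge-sym a b with coreEdge a b Bool.≟ true | coreEdge b a Bool.≟ true
  ... | yes p | _     = trans p (≡.sym (coreEdge-flip p))
  ... | no ¬p | yes q = ⊥-elim (¬p (coreEdge-flip q))
  ... | no ¬p | no ¬q = trans (¬-not ¬p) (≡.sym (¬-not ¬q))

  coreEdge-irrefl : ∀ a → coreEdge a a ≡ false
  coreEdge-irrefl a = ¬-not (λ h → Edge-≢ G (proj₁ (proj₂ (coreEdge⁻ h))) refl)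

  coreDeg : Fin n → ℕ
  coreDeg a = count (coreEdge a)

  coreDeg≡K : ∀ {a} → Core a → coreDeg a ≡ K a
  coreDeg≡K {a} ca = sum-cong (λ b → cong (λ p → ⟦ p ∧ coreAdj G a b ⟧) ca)

  -- A neighbour outside the core would be a leaf at `v`, excluded by `no-leaf`.
  neighbour-in-core : ∀ {v b} → K v ≤ 6 → Edge G v b → Core b
  neighbour-in-core {v} {b} K≤6 vb with 2 ≤? deg G b
  ... | yes 2≤b = core 2≤b
  ... | no  2≰b = ⊥-elim (no-leaf v b vb (s≤s⁻¹ (≰⇒> 2≰b)) K≤6)

  -- Translates between core degrees, on which the discharging rests, and the degrees in `G` that
  -- the reducible configurations speak of.
  small-deg : ∀ {v} → K v ≤ 6 → deg G v ≡ K v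
  small-deg {v} K≤6 = ≤-antisym
    (count-mono (adj G v) (coreAdj G v) (λ b vb → ∧-true⁺ vb (neighbour-in-core K≤6 vb)))
    (count-mono (coreAdj G v) (adj G v) (λ b → proj₁ ∘ ∧-true))

  deg2 : ∀ {v} → K v ≡ 2 → deg G v ≡ 2
  deg2 K≡2 = trans (small-deg (subst (_≤ 6) (≡.sym K≡2) (m≤m+n 2 4))) K≡2

  2≤K : ∀ {v} → Core v → 2 ≤ K v
  2≤K {v} cv with K v ≤? 6
  ... | yes K≤6 = subst (2 ≤_) (small-deg K≤6) (dec-true⁻ (2 ≤? deg G v) cv)
  ... | no  K≰6 = ≤-trans (s≤s (s≤s z≤n)) (≰⇒> K≰6)

  another : ∀ {v} → Core v → ∀ x → ∃ λ y → y ≢ x × Edge G v y × Core y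
  another {v} cv x = let y , y≢x , h = count-other {p = coreAdj G v} (2≤K cv) x in y , y≢x , ∧-true h

  Gives : Fin n → Fin n → Set
  Gives a b = K b ≡ 2 ⊎ 7 ≤ K a

  gives? : ∀ a b → Dec (Gives a b)
  gives? a b = (K b ≟ 2) ⊎-dec (7 ≤? K a)

  give : Fin n → Fin n → Bool
  give a b = coreEdge a b ∧ does (gives? a b)

  give⁺ : ∀ {a b} → coreEdge a b ≡ true → Gives a b → give a b ≡ true
  give⁺ {a} {b} h g = ∧-true⁺ h (dec-true (gives? a b) g)

  give⁻ : ∀ {a b} → give a b ≡ true → coreEdge a b ≡ true × Gives a b
  give⁻ {a} {b} h = let e , g = ∧-true {coreEdge a b} h in e , dec-true⁻ (gives? a b) g

  given received : Fin n → ℕ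
  given a    = count (give a)
  received a = count (λ b → give b a)

  -- Charges are doubled: vertex a starts with 2 deg a − 6 and hands 1 along each giving edge.
  spent budget : Fin n → ℕ
  spent a  = 6 * ⟦ inCore G a ⟧ + given a
  budget a = 2 * coreDeg a + received a

  spent≡ : ∀ {a} → Core a → spent a ≡ 6 + given a
  spent≡ {a} ca = cong (λ k → 6 * k + given a) (⟦⟧-true ca)

  budget≡ : ∀ {a} → Core a → budget a ≡ 2 * K a + received a
  budget≡ {a} ca = cong (λ k → 2 * k + received a) (coreDeg≡K ca)

  none-given : ∀ {a} → ¬ 7 ≤ K a → (∀ b → coreEdge a b ≡ true → K b ≢ 2) → given a ≡ 0
  none-given {a} ¬big no2 = count-none (give a) nothing
    where
    nothing : ∀ b → ¬ give a b ≡ true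
    nothing b g with give⁻ g
    ... | ab , inj₁ Kb≡2 = no2 b ab Kb≡2
    ... | ab , inj₂ big  = ¬big big

  -- Comparing `spent` with `budget` expresses the sign of the final charge without subtraction.
  -- `strict` is a positive charge; `thin` and `cubic` are the only cases where it may vanish.
  data Balance (a : Fin n) : Set where
    strict : spent a < budget a → Balance a
    thin   : K a ≡ 2 → spent a ≤ budget a → Balance a
    cubic  : K a ≡ 3 → (∀ b → coreEdge a b ≡ true → K b ≢ 2) → spent a ≤ budget a → Balance a

  -- At most 1 goes to each core neighbour, leaving at least (2K - 6) - K = K - 6 > 0, where K is
  -- `K a`.
  balance-big : ∀ {a} → Core a → 7 ≤ K a → spent a < budget a
  balance-big {a} ca 7≤K = begin-strict
    spent a              ≡⟨ spent≡ ca ⟩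
    6 + given a          <⟨ +-mono-≤ 7≤K (count-mono (give a) (coreEdge a) (λ b → proj₁ ∘ give⁻)) ⟩
    K a + coreDeg a      ≡⟨ cong (_+ coreDeg a) (≡.sym (coreDeg≡K ca)) ⟩
    coreDeg a + coreDeg a ≡⟨ cong (coreDeg a +_) (≡.sym (+-identityʳ (coreDeg a))) ⟩
    2 * coreDeg a        ≤⟨ m≤m+n _ (received a) ⟩
    budget a             ∎
    where open ≤-Reasoning

  -- The deficit 2 · 2 - 6 = -2 is paid by the two core neighbours, 1 each. Nothing is given away,
  -- because `no-thin` rules out a neighbour of core degree 2.
  balance-thin : ∀ {a} → Core a → K a ≡ 2 → spent a ≤ budget a
  balance-thin {a} ca K≡2 = begin
    spent a              ≡⟨ spent≡ ca ⟩
    6 + given a          ≡⟨ cong (6 +_) (none-given (<⇒≱ (subst (_< 7) (≡.sym K≡2) (m≤m+n 3 4))) no2) ⟩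
    2 * 2 + 2            ≡⟨ cong₂ (λ k l → 2 * k + l) (≡.sym D≡2) (≡.sym D≡2) ⟩
    2 * coreDeg a + coreDeg a ≤⟨ +-monoʳ-≤ (2 * coreDeg a) (count-mono (coreEdge a) (λ b → give b a)
                                  (λ b h → give⁺ (coreEdge-flip h) (inj₁ K≡2))) ⟩
    budget a             ∎
    where
    open ≤-Reasoning
    D≡2 : coreDeg a ≡ 2
    D≡2 = trans (coreDeg≡K ca) K≡2
    no2 : ∀ b → coreEdge a b ≡ true → K b ≢ 2
    no2 b h Kb≡2 = no-thin a b (proj₁ (proj₂ (coreEdge⁻ h))) (deg2 K≡2) (deg2 Kb≡2)

  -- All neighbours other than x are big, so a receives at least K a − 1 and gives only to x.
  balance-fork : ∀ {a x} → Core a → 3 ≤ K a → K a ≤ 6 → coreEdge a x ≡ true → K x ≡ 2 → spent a < budget a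
  balance-fork {a} {x} ca 3≤K K≤6 ax Kx≡2 = begin-strict
    spent a              ≡⟨ spent≡ ca ⟩
    6 + given a          ≤⟨ +-monoʳ-≤ 6 (count≤1 x only-x) ⟩
    -- With `K a` at least 3, at least 2 is received, so the budget is at least 2 · 3 + 2 = 8.
    7                    <⟨ +-mono-≤ (*-monoʳ-≤ 2 3≤K) (s≤s⁻¹ (≤-trans 3≤K K≤1+received)) ⟩
    2 * K a + received a ≡⟨ ≡.sym (budget≡ ca) ⟩
    budget a             ∎
    where
    open ≤-Reasoning
    others-big : ∀ b → coreEdge a b ≡ true → b ≢ x → 7 ≤ K b
    others-big b ab b≢x with K b ≤? 6
    ... | no  Kb≰6 = ≰⇒> Kb≰6
    -- Here the degree sum of `a` and `x` is at most 6 + 2, exactly what the fork tolerates.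
    ... | yes Kb≤6 = ⊥-elim (no-fork a x b (proj₁ (proj₂ (coreEdge⁻ ax))) (proj₁ (proj₂ (coreEdge⁻ ab))) b≢x
        (+-mono-≤ (subst (_≤ 6) (≡.sym (small-deg K≤6)) K≤6)
          (≤-reflexive (deg2 Kx≡2)))
        (subst (_≤ 6) (≡.sym (small-deg Kb≤6)) Kb≤6))
    only-x : ∀ b → give a b ≡ true → b ≡ x
    only-x b g with b Fin.≟ x | give⁻ g
    ... | yes b≡x | _              = b≡x
    ... | no  b≢x | ab , inj₂ big  = ⊥-elim (<⇒≱ big K≤6)
    ... | no  b≢x | ab , inj₁ Kb≡2 = ⊥-elim (<⇒≱ (m≤m+n 3 4) (subst (7 ≤_) Kb≡2 (others-big b ab b≢x)))
    isx : Fin n → Bool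
    isx b = does (b Fin.≟ x)
    cover : ∀ b → ⟦ coreEdge a b ⟧ ≤ ⟦ isx b ⟧ + ⟦ give b a ⟧
    cover b with b Fin.≟ x
    ... | yes _   = ≤-trans (⟦⟧≤1 (coreEdge a b)) (m≤m+n 1 _)
    ... | no  b≢x = ⟦⟧-mono (λ ab → give⁺ (coreEdge-flip ab) (inj₂ (others-big b ab b≢x)))
    K≤1+received : K a ≤ 1 + received a
    K≤1+received = begin
      K a                  ≡⟨ ≡.sym (coreDeg≡K ca) ⟩
      coreDeg a            ≤⟨ sum-mono cover ⟩
      sumFin (λ b → ⟦ isx b ⟧ + ⟦ give b a ⟧) ≡⟨ sum-+ (λ b → ⟦ isx b ⟧) (λ b → ⟦ give b a ⟧) ⟩
      count isx + received a ≤⟨ +-monoˡ-≤ (received a) (count≤1 x (λ b → dec-true⁻ (b Fin.≟ x))) ⟩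
      1 + received a       ∎

  -- Such a vertex gives nothing. Taking `k` to be 3 yields a nonnegative charge, taking it to be 4
  -- a positive one.
  balance-plain : ∀ {a k} → Core a → k ≤ K a → K a ≤ 6 → (∀ b → coreEdge a b ≡ true → K b ≢ 2) →
    spent a ≡ 6 × 2 * k ≤ budget a
  balance-plain {a} ca k≤K K≤6 no2 =
      trans (spent≡ ca) (cong (6 +_) (none-given (<⇒≱ (s≤s K≤6)) no2))
    , ≤-trans (*-monoʳ-≤ 2 k≤K) (≤-trans (m≤m+n _ (received a)) (≤-reflexive (≡.sym (budget≡ ca))))

  balance : ∀ {a} → Core a → Balance a
  balance {a} ca with K a ≤? 6 | K a ≟ 2 | K a ≟ 3
    | any? (λ x → (coreEdge a x Bool.≟ true) ×-dec (K x ≟ 2))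
  ... | no K≰6  | _       | _       | _                   = strict (balance-big ca (≰⇒> K≰6))
  ... | yes _   | yes K≡2 | _       | _                   = thin K≡2 (balance-thin ca K≡2)
  ... | yes K≤6 | no K≢2  | _       | yes (x , ax , Kx≡2) =
    strict (balance-fork ca (≤∧≢⇒< (2≤K ca) (≢-sym K≢2)) K≤6 ax Kx≡2)
  ... | yes K≤6 | no K≢2  | yes K≡3 | no none =
    let no2 b ab Kb≡2 = none (b , ab , Kb≡2)
        spent≡6 , 6≤ = balance-plain ca (≤-reflexive (≡.sym K≡3)) K≤6 no2
    in cubic K≡3 no2 (≤-trans (≤-reflexive spent≡6) 6≤)
  ... | yes K≤6 | no K≢2  | no K≢3  | no none =
    let no2 b ab Kb≡2 = none (b , ab , Kb≡2)
        spent≡6 , 8≤ = balance-plain ca (≤∧≢⇒< (≤∧≢⇒< (2≤K ca) (≢-sym K≢2)) (≢-sym K≢3)) K≤6 no2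
    in strict (≤-trans (s≤s (≤-reflexive spent≡6)) (≤-trans (n≤1+n 7) 8≤))

  spent≤budget : ∀ a → spent a ≤ budget a
  spent≤budget a with inCore G a Bool.≟ true
  ... | no ¬ca = ≤-trans (≤-reflexive (cong₂ (λ k l → 6 * k + l) (⟦⟧-false ¬ca)
      (count-none (give a) (λ b g → ¬ca (proj₁ (coreEdge⁻ (proj₁ (give⁻ g)))))))) z≤n
  ... | yes ca with balance ca
  ...   | strict lt    = <⇒≤ lt
  ...   | thin _ le    = le
  ...   | cubic _ _ le = le

  coreGraph : Subgraph G
  coreGraph = record
    { S = inCore G ; F = coreEdge ; F-sym = coreEdge-sym
    ; F⊆E = λ a b h → proj₁ (proj₂ (coreEdge⁻ h))
    ; F⊆S = λ a b h → let ca , _ , cb = coreEdge⁻ h in ca , cb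
    }

  -- Discharging only moves charge: exchanging the summations identifies the totals of `received`
  -- and `given`. The rest is the mad bound for the core, which `v` shows to be non-empty: its
  -- degree sum is at most 3 times its order.
  budget≤spent : ∀ {v} → Core v → sumFin budget ≤ sumFin spent
  budget≤spent {v} cv = begin
    sumFin budget                          ≡⟨ sum-+ (λ a → 2 * coreDeg a) received ⟩
    sumFin (λ a → 2 * coreDeg a) + sumFin received
      ≡⟨ cong₂ _+_ (sum-* 2 coreDeg) (sum-swap (λ a b → ⟦ give b a ⟧)) ⟩
    2 * sumFin coreDeg + sumFin given
      ≤⟨ +-monoˡ-≤ (sumFin given) (*-monoʳ-≤ 2 (≤-trans (handshake-≤ coreEdge coreEdge-sym coreEdge-irrefl)
           (mad coreGraph (≤-trans (≤-reflexive (≡.sym (⟦⟧-true cv))) (term≤sum (λ a → ⟦ inCore G a ⟧) v))))) ⟩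
    2 * (3 * numV coreGraph) + sumFin given
      ≡⟨ cong (_+ sumFin given) (trans (≡.sym (*-assoc 2 3 (numV coreGraph))) (≡.sym (sum-* 6 (λ a → ⟦ inCore G a ⟧)))) ⟩
    sumFin (λ a → 6 * ⟦ inCore G a ⟧) + sumFin given ≡⟨ ≡.sym (sum-+ (λ a → 6 * ⟦ inCore G a ⟧) given) ⟩
    sumFin spent                           ∎
    where open ≤-Reasoning

  not-strict : ∀ {a} → Core a → ¬ spent a < budget a
  not-strict {a} ca lt = <⇒≱ (sum-strict spent≤budget a lt) (budget≤spent ca)

  cubic-core : ∀ {a} → Core a → K a ≡ 3
  cubic-core {a} ca with balance ca
  ... | strict lt     = ⊥-elim (not-strict ca lt)
  ... | cubic K≡3 _ _ = K≡3
  ... | thin K≡2 _ with another ca a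
  -- No balance of the core neighbour `p` tolerates a thin `a`: a positive charge contradicts the
  -- total, a cubic `p` has no thin neighbour, and two adjacent thin vertices are reducible.
  ...   | p , _ , ap , cp with balance cp
  ...     | strict lt     = ⊥-elim (not-strict cp lt)
  ...     | cubic _ no2 _ = ⊥-elim (no2 a (coreEdge⁺ cp (Edge-sym G ap) ca) K≡2)
  ...     | thin Kp≡2 _   = ⊥-elim (no-thin a p ap (deg2 K≡2) (deg2 Kp≡2))
  -- In a cubic core any two edges at a vertex form a fork, as 3 + 3 ≤ 8 and 3 ≤ 6.
  no-core : ∀ {a} → ¬ Core a
  no-core {a} ca with another ca a
  ... | x , _ , ax , cx with another ca x
  ...   | x′ , x′≢x , ax′ , cx′ = no-fork a x x′ ax ax′ x′≢x
          (≤-trans (≤-reflexive (cong₂ _+_ (deg3 ca) (deg3 cx))) (m≤m+n 6 2))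
          (≤-trans (≤-reflexive (deg3 cx′)) (m≤m+n 3 3))
    where
    deg3 : ∀ {v} → Core v → deg G v ≡ 3
    deg3 cv = trans (small-deg (subst (_≤ 6) (≡.sym (cubic-core cv)) (m≤m+n 3 3))) (cubic-core cv)

  -- Any edge would put a vertex into the core: `v` if `K u` is at most 6, since it cannot be a
  -- leaf, and otherwise `u`.
  no-edge : ∀ u v → ¬ Edge G u v
  no-edge u v uv with K u ≤? 6
  ... | yes K≤6 = no-core (neighbour-in-core K≤6 uv)
  ... | no  K≰6 = no-core {u} (core (≤-trans (s≤s (s≤s z≤n)) (≤-trans (≰⇒> K≰6)
                    (count-mono (coreAdj G u) (adj G u) (λ b → proj₁ ∘ ∧-true)))))

-- Induction on the number of edges

empty-solution : (G : Graph n) (L : List ℕ) → (∀ u v → ¬ Edge G u v) → Solution G L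
empty-solution G L no-edge = record
  { wt      = λ _ _ → 0
  ; wt-sym  = λ _ _ → refl
  ; wt-off  = λ _ _ _ → refl
  ; wt∈L    = λ a b ab → ⊥-elim (no-edge a b ab)
  ; wt-inj  = λ a b _ _ ab → ⊥-elim (no-edge a b ab)
  ; used    = []
  ; wt∈used = λ a b ab → ⊥-elim (no-edge a b ab)
  ; used≤   = z≤n
  } , λ a b ab → ⊥-elim (no-edge a b ab)

-- The bound `m` makes the recursion structural. `L` stays fixed while edges disappear, so the
-- requirement on its length is inherited.
solve : ∀ m (G : Graph n) {L : List ℕ} → numEdges G < m → madAtMost3 G → Unique L →
  numEdges G + 6 ≤ length L → Solution G L
solve (suc m) G {L} (s≤s ≤m) mad uL enough
  with any? (λ u → any? (λ v → (adj G u v Bool.≟ true) ×-dec (deg G v ≤? 1) ×-dec (count (coreAdj G u) ≤? 6)))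
     | any? (λ x → any? (λ y → (adj G x y Bool.≟ true) ×-dec (deg G x ≟ 2) ×-dec (deg G y ≟ 2)))
     | any? (λ u → any? (λ x → any? (λ x′ → (adj G u x Bool.≟ true) ×-dec (adj G u x′ Bool.≟ true) ×-dec
         ¬? (x′ Fin.≟ x) ×-dec (deg G u + deg G x ≤? 8) ×-dec (deg G x′ ≤? 6))))
... | yes (u , v , uv , v≤1 , u≤6) | _ | _ = leaf-reduction G uL enough uv v≤1 u≤6
      (solve m (delete G u v) (≤-trans fewer ≤m) (delete-mad G mad) uL
        (≤-trans (+-monoˡ-≤ 6 (<⇒≤ fewer)) enough))
  where
  fewer : numEdges (delete G u v) < numEdges G
  fewer = delete-numEdges-< G uv
... | no _ | yes (x , y , xy , x≡2 , y≡2) | _ = thin-reduction G uL enough xy x≡2 y≡2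
      (solve m (delete G x y) (≤-trans fewer ≤m) (delete-mad G mad) uL
        (≤-trans (+-monoˡ-≤ 6 (<⇒≤ fewer)) enough))
  where
  fewer : numEdges (delete G x y) < numEdges G
  fewer = delete-numEdges-< G xy
... | no _ | no _ | yes (u , x , x′ , ux , ux′ , x′≢x , ux≤8 , x′≤6) =
      fork-reduction G uL enough ux ux′ x′≢x ux≤8 x′≤6
        (solve m (delete (delete G u x) u x′) (≤-trans fewer ≤m) (delete-mad (delete G u x) (delete-mad G mad)) uL
          (≤-trans (+-monoˡ-≤ 6 (<⇒≤ fewer)) enough))
  where
  fewer : numEdges (delete (delete G u x) u x′) < numEdges G
  fewer = <-trans (delete-numEdges-< (delete G u x)
    (delete-keeps G (¬Joins-other x′≢x (≢-sym (Edge-≢ G ux′))) ux′)) (delete-numEdges-< G ux)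
... | no no-leaf | no no-thin | no no-fork = empty-solution G L (Discharging.no-edge G mad
      (λ u v uv v≤1 u≤6 → no-leaf (u , v , uv , v≤1 , u≤6))
      (λ x y xy x≡2 y≡2 → no-thin (x , y , xy , x≡2 , y≡2))
      (λ u x x′ ux ux′ x′≢x ux≤8 x′≤6 → no-fork (u , x , x′ , ux , ux′ , x′≢x , ux≤8 , x′≤6)))

-- Edges at leaves, and the passage from labellings to weightings

module _ (G : Graph n) (nice : Nice G) {L : List ℕ} (positive : ∀ {x} → x ∈ L → 0 < x) (ℓ : Labelling G L) where
  open Labelling ℓ

  vsum-σ : ∀ a → σ G wt a ≡ vsum a
  vsum-σ a = sum-cong restrict
    where
    restrict : ∀ b → (if adj G a b then wt a b else 0) ≡ wt a b
    restrict b with adj G a b in eq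
    ... | true  = refl
    ... | false = ≡.sym (wt-off a b (not-¬ eq))

  -- By niceness `a` has a second neighbour `x`, and the positive weight of `ax` comes on top of the
  -- weight of `ab`, which is all that `b` sees.
  vsum-leaf-< : ∀ {a b} → Edge G a b → deg G b ≤ 1 → vsum b < vsum a
  vsum-leaf-< {a} {b} ab b≤1 with any? (λ x → ¬? (x Fin.≟ b) ×-dec (adj G a x Bool.≟ true))
  ... | yes (x , x≢b , ax) = begin-strict
    vsum b          ≡⟨ vsum-leaf (λ y by → count-unique (adj G b) b≤1 by (Edge-sym G ab)) ⟩
    wt b a          ≡⟨ wt-sym b a ⟩
    wt a b          <⟨ m<m+n (wt a b) (positive (wt∈L a x ax)) ⟩
    wt a b + wt a x ≤⟨ two-terms≤sum (wt a) (≢-sym x≢b) ⟩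
    vsum a          ∎
    where open ≤-Reasoning
  ... | no none = ⊥-elim (nice (a , b , ab , only , λ y by → count-unique (adj G b) b≤1 by (Edge-sym G ab)))
    where
    only : ∀ x → Edge G a x → x ≡ b
    only x ax with x Fin.≟ b
    ... | yes x≡b = x≡b
    ... | no  x≢b = ⊥-elim (none (x , x≢b , ax))

  distinguishes : Distinguishing ℓ → NeighbourSumDistinguishing G wt
  distinguishes dist a b ab eq with 2 ≤? deg G a | 2 ≤? deg G b
  ... | yes 2≤a | yes 2≤b = dist a b ab 2≤a 2≤b (trans (≡.sym (vsum-σ a)) (trans eq (vsum-σ b)))
  ... | _       | no 2≰b  = <⇒≢ (vsum-leaf-< ab (s≤s⁻¹ (≰⇒> 2≰b)))
                              (trans (≡.sym (vsum-σ b)) (trans (≡.sym eq) (vsum-σ a)))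
  ... | no 2≰a  | yes _   = <⇒≢ (vsum-leaf-< (Edge-sym G ab) (s≤s⁻¹ (≰⇒> 2≰a)))
                              (trans (≡.sym (vsum-σ a)) (trans eq (vsum-σ b)))

good-weighting : (G : Graph n) → Nice G → madAtMost3 G →
  (W : Fin (numEdges G + 6) → ℕ) → Injective _≡_ _≡_ W → (∀ i → 0 < W i) →
  GoodWeighting G (λ x → Σ (Fin (numEdges G + 6)) (λ i → W i ≡ x))
good-weighting G nice mad W W-inj W-pos
  with solve (suc (numEdges G)) G {tabulate W} ≤-refl mad (Uniqueₚ.tabulate⁺ W-inj)
         (≤-reflexive (≡.sym (length-tabulate W)))
... | ℓ , dist = wt , (λ a b _ → wt-sym a b)
    , (λ a b ab → let i , eq = ∈-tabulate⁻ (wt∈L a b ab) in i , ≡.sym eq)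
    , wt-inj , distinguishes G nice positive ℓ dist
  where
  open Labelling ℓ
  positive : ∀ {x} → x ∈ tabulate W → 0 < x
  positive x∈ = let i , eq = ∈-tabulate⁻ x∈ in subst (0 <_) (≡.sym eq) (W-pos i)

theorem5p5 : ∀ {n} (G : Graph n) → Nice G → madAtMost3 G →
    (∀ (W : Fin (numEdges G + 6) → ℕ) → Injective _≡_ _≡_ W → (∀ i → 0 < W i) →
    GoodWeighting G (λ x → Σ (Fin (numEdges G + 6)) (λ i → W i ≡ x)))
    × chiE1≤ G (numEdges G + 6)
theorem5p5 {n} G nice mad = good-weighting G nice mad , initial-segment
  where
  initial-segment : chiE1≤ G (numEdges G + 6)
  -- The weights 1 to |E(G)| + 6, enumerated from `zero`, hence the shift by `suc`.
  initial-segment with good-weighting G nice mad (suc ∘ toℕ) (toℕ-injective ∘ cong pred) (λ _ → s≤s z≤n)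
  ... | w , w-sym , w-val , w-rest = w , w-sym
      , (λ a b ab → let i , eq = w-val a b ab in subst (λ x → 1 ≤ x × x ≤ numEdges G + 6) eq (s≤s z≤n , toℕ<n i))
      , w-rest
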